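{- Let $P:=R_1\cup\ldots\cup R_n$ be a well-typed general logic program such that $R_n\sqsupset\ldots\sqsupset R_1$ is a hierarchy, and let $|\ |_1,\ldots,|\ |_n$ be level mappings for $R_1,\ldots,R_n$, respectively. Suppose that for every well-typed atom $A$ and every $i\in\{1,\ldots,n\}$, if $A$ is defined in $R_i$ then $A$ is bounded with respect to $|\ |_i$. Then every well-typed query is strongly bounded with respect to $P$ and $|\ |_1,\ldots,|\ |_n$.
   Context: **Programs.** All programs and queries are over a fixed first-order language with at least one constant. A literal is an atom or a negated atom. A (general) clause is $H\leftarrow L_1,\ldots,L_n$ ($n\ge 0$), $H$ an atom, $L_i$ literals. A (general) query is a finite, possibly empty, sequence of literals. A (general) program is a finite set of clauses. $\mathit{rel}(L)$ is the predicate symbol of $L$. $B_P$ is the set of ground atoms whose predicate symbol occurs in $P$. **LDNF-resolution (leftmost selection rule).** For a program $P$ and a non-empty query $Q=L,\mathbf{L}$: (i) if $L=A$ is an atom, the resolvents of $Q$ are the queries $(\mathbf{B},\mathbf{L})\theta$ for $H\leftarrow\mathbf{B}$ a variant of a clause of $P$ renamed apart from $Q$ and $\theta=\mathrm{mgu}(A,H)$; (ii) if $L=\neg A$ with $A$ ground, a subsidiary LDNF-tree for $P\cup\{A\}$ is constructed; if this tree is finite and finitely failed, $Q$ has the single resolvent $\mathbf{L}$; if it is finite and has a successful branch, $Q$ fails; if its construction diverges, the derivation containing $Q$ is considered infinite; (iii) if $L=\neg A$ with $A$ non-ground, the derivation flounders: it ends with no resolvent. A branch is successful if it ends in the empty query;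 it is failed if it ends in a query whose first literal is positive with no resolvent, or negative and ground with a finite subsidiary tree having a successful branch. A tree is finitely failed if it is finite and all its branches are failed. The LDNF-descendants of $P\cup\{Q\}$ are all queries occurring during LDNF-resolution of $P\cup\{Q\}$, including $Q$ itself and all queries occurring in the construction of all (nested) subsidiary LDNF-trees (including their roots). $\mathit{first}(Q)$ is the first literal of a non-empty query, and $\mathit{Call}_P(Q)=\{\mathit{first}(Q') : Q' \text{ a (non-empty) LDNF-descendant of } P\cup\{Q\}\}$. **Types.** A type is a set of terms closed under substitution. Every $n$-ary predicate $p$ has a fixed mode $m_p:\{1,\ldots,n\}\to\{+,-\}$ ($+$ input, $-$ output position) and a fixed assignment $t_p$ of a type to each position. A type judgement $\mathbf{s}:\mathbf{S}\Rightarrow\mathbf{t}:\mathbf{T}$ is true, written $\models\mathbf{s}:\mathbf{S}\Rightarrow\mathbf{t}:\mathbf{T}$, if for all substitutions $\theta$, $\mathbf{s}\theta\in\mathbf{S}$ implies $\mathbf{t}\theta\in\mathbf{T}$ (componentwise). For a literal $L_s$ (positive or negative), $\mathbf{i}_s:\mathbf{I}_s$ and $\mathbf{o}_s:\mathbf{O}_s$ denote the sequences of terms, with the associated types, in its input and output positions. A query $L_1,\ldots,L_n$ is well-typed if for all $j\in\{1,\ldots,n\}$, $\models\mathbf{o}_{j_1}:\mathbf{O}_{j_1},\ldots,\mathbf{o}_{j_k}:\mathbf{O}_{j_k}\Rightarrow\mathbf{i}_j:\mathbf{I}_j$, where $L_{j_1},\ldots,L_{j_k}$ are all the positive literals in $L_1,\ldots,L_{j-1}$.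 A clause $L_0\leftarrow L_1,\ldots,L_n$ is well-typed if for all $j\in\{1,\ldots,n\}$, $\models\mathbf{i}_0:\mathbf{I}_0,\mathbf{o}_{j_1}:\mathbf{O}_{j_1},\ldots,\mathbf{o}_{j_k}:\mathbf{O}_{j_k}\Rightarrow\mathbf{i}_j:\mathbf{I}_j$, where $L_{j_1},\ldots,L_{j_k}$ are all the positive literals in $L_1,\ldots,L_{j-1}$, and moreover $\models\mathbf{i}_0:\mathbf{I}_0,\mathbf{o}_{j_1}:\mathbf{O}_{j_1},\ldots,\mathbf{o}_{j_h}:\mathbf{O}_{j_h}\Rightarrow\mathbf{o}_0:\mathbf{O}_0$, where $L_{j_1},\ldots,L_{j_h}$ are all the positive literals in $L_1,\ldots,L_n$. A program is well-typed if all its clauses are. A well-typed atom is an atom which is well-typed as a one-literal query. **Level mappings, boundedness.** A level mapping for $P$ is a function $|\ |:B_P\to\mathbf{N}$, extended to ground literals by $|\neg A|=|A|$. An atom $A$ is bounded w.r.t. $|\ |$ if $\{|A'| : A' \text{ a ground instance of } A\}$ is finite. **Hierarchy.** A relation is defined in $P$ if it occurs in the head of a clause of $P$; a literal $L$ is defined in $P$ if $\mathit{rel}(L)$ is. $P$ extends $R$, written $P\sqsupset R$, if no relation defined in $P$ occurs in $R$. $R_n\sqsupset\cdots\sqsupset R_1$ is a hierarchy if $R_{i+1}\sqsupset(R_1\cup\cdots\cup R_i)$ for all $i\in\{1,\ldots,n-1\}$. **Strong boundedness.** For such a hierarchy with $P=R_1\cup\ldots\cup R_n$ and level mappings $|\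 |_i$ for $R_i$, a query $Q$ is strongly bounded w.r.t. $P$ and $|\ |_1,\ldots,|\ |_n$ if for all atoms $A\in\mathit{Call}_P(Q)$ and all $i\in\{1,\ldots,n\}$, if $A$ is defined in $R_i$ then $A$ is bounded w.r.t. $|\ |_i$. -}

module Defs where

open import Data.Nat.Base using (ℕ; _≤_)
open import Data.Fin.Base using (Fin; toℕ)
open import Data.Vec.Base using (Vec; []; _∷_) renaming (lookup to lookupᵛ)
open import Data.List.Base
  using (List; []; _∷_; [_]; _++_; map; concat; concatMap; filter; take;
         length; lookup; allFin; tabulate)
open import Data.List.Membership.Propositional using (_∈_)
open import Data.List.Relation.Unary.All using (All; []; _∷_)
open import Data.List.Relation.Unary.Any using (Any)
open import Data.List.Relation.Binary.Disjoint.Propositional using (Disjoint)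
open import Data.Product.Base using (Σ; ∃; _×_; _,_)
open import Level using (Level; _⊔_; 0ℓ)
open import Relation.Binary.Definitions using (DecidableEquality)
open import Relation.Binary.PropositionalEquality.Core using (_≡_; refl)
open import Relation.Nullary using (¬_; yes; no)
open import Relation.Unary using (Pred; _≐_)

Finite : {a ℓ : Level} {A : Set a} → Pred A ℓ → Set (a ⊔ ℓ)
Finite P = ∃ λ xs → P ≐ (_∈ xs)

record Language : Set₁ where
  field
    Fun            : Set
    arity          : Fun → ℕ
    Rel            : Set
    relArity       : Rel → ℕ
    constant       : Fun
    constant-arity : arity constant ≡ 0

data Mode : Set where
  input output : Mode

_≟ᵐ_ : DecidableEquality Mode
input  ≟ᵐ input  = yes refl
input  ≟ᵐ output = no λ ()
output ≟ᵐ input  = no λ ()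
output ≟ᵐ output = yes refl

module LogicPrograms (ℒ : Language) where
  open Language ℒ

  data Term : Set where
    var : ℕ → Term
    fun : (f : Fun) → Vec Term (arity f) → Term

  record Atom : Set where
    constructor atom
    field
      rel  : Rel
      args : Vec Term (relArity rel)
  open Atom public

  data Literal : Set where
    pos neg : Atom → Literal

  relᴸ : Literal → Rel
  relᴸ (pos A) = rel A
  relᴸ (neg A) = rel A

  Query : Set
  Query = List Literal

  infix 4 _⟵_
  record Clause : Set where
    constructor _⟵_
    field
      head : Atom
      body : Query
  open Clause public

  -- A finite set of clauses; order and repetitions in the list play no role.
  Program : Set
  Program = List Clause

  ⋃ : List Program → Program
  ⋃ = concat

  mutual
    varsᵀ : Term → List ℕ
    varsᵀ (var x)    = [ x ]
    varsᵀ (fun f ts) = varsᵛ ts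

    varsᵛ : ∀ {n} → Vec Term n → List ℕ
    varsᵛ []       = []
    varsᵛ (t ∷ ts) = varsᵀ t ++ varsᵛ ts

  varsᴬ : Atom → List ℕ
  varsᴬ A = varsᵛ (args A)

  varsᴸ : Literal → List ℕ
  varsᴸ (pos A) = varsᴬ A
  varsᴸ (neg A) = varsᴬ A

  varsᵠ : Query → List ℕ
  varsᵠ = concatMap varsᴸ

  varsᶜ : Clause → List ℕ
  varsᶜ (H ⟵ B) = varsᴬ H ++ varsᵠ B

  Ground : Atom → Set
  Ground A = varsᴬ A ≡ []

  -- As usual in logic programming, a substitution moves only finitely
  -- many variables.
  record Subst : Set where
    field
      ⟦_⟧   : ℕ → Term
      bound : ℕ
      fixes : ∀ x → bound ≤ x → ⟦_⟧ x ≡ var x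
  open Subst public

  infixl 8 _[_]ᵀ _[_]ᵛ _[_]ᴬ _[_]ᴸ _[_]ᵠ _[_]ᶜ

  mutual
    _[_]ᵀ : Term → Subst → Term
    var x    [ σ ]ᵀ = ⟦ σ ⟧ x
    fun f ts [ σ ]ᵀ = fun f (ts [ σ ]ᵛ)

    _[_]ᵛ : ∀ {n} → Vec Term n → Subst → Vec Term n
    []       [ σ ]ᵛ = []
    (t ∷ ts) [ σ ]ᵛ = t [ σ ]ᵀ ∷ ts [ σ ]ᵛ

  _[_]ᴬ : Atom → Subst → Atom
  atom p ts [ σ ]ᴬ = atom p (ts [ σ ]ᵛ)

  _[_]ᴸ : Literal → Subst → Literal
  pos A [ σ ]ᴸ = pos (A [ σ ]ᴬ)
  neg A [ σ ]ᴸ = neg (A [ σ ]ᴬ)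

  _[_]ᵠ : Query → Subst → Query
  Q [ σ ]ᵠ = map (_[ σ ]ᴸ) Q

  _[_]ᶜ : Clause → Subst → Clause
  (H ⟵ B) [ σ ]ᶜ = H [ σ ]ᴬ ⟵ B [ σ ]ᵠ

  _InstanceOf_ : Atom → Atom → Set
  A′ InstanceOf A = ∃ λ σ → A′ ≡ A [ σ ]ᴬ

  _VariantOf_ : Clause → Clause → Set
  c′ VariantOf c = (∃ λ σ → c′ ≡ c [ σ ]ᶜ) × (∃ λ σ → c ≡ c′ [ σ ]ᶜ)

  Unifies : Subst → Atom → Atom → Set
  Unifies σ A B = A [ σ ]ᴬ ≡ B [ σ ]ᴬ

  MGU : Subst → Atom → Atom → Set
  MGU θ A B = Unifies θ A B
            × (∀ σ → Unifies σ A B → ∃ λ γ → ∀ x → ⟦ σ ⟧ x ≡ ⟦ θ ⟧ x [ γ ]ᵀ)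

  -- Any suitable variant and any mgu may be used.
  data ResolventVia (c : Clause) : Query → Query → Set where
    resolvent : ∀ {A Ls H B θ} →
                (H ⟵ B) VariantOf c →
                Disjoint (varsᶜ (H ⟵ B)) (varsᵠ (pos A ∷ Ls)) →
                MGU θ A H →
                ResolventVia c (pos A ∷ Ls) ((B ++ Ls) [ θ ]ᵠ)

  -- A branch is `floundered' if it is neither
  -- successful nor failed: its last query starts with a negative literal
  -- that is non-ground, or is ground with a finite subsidiary tree that
  -- is neither finitely failed nor has a successful branch.
  data Outcome : Set where
    successful failed floundered : Outcome

  -- Finite LDNF-trees, all of whose subsidiary trees are finite as well.
  -- A node whose first literal is positive has one child per clause of P
  -- that can be used, whence all such trees for a given query agree up to
  -- variants.
  mutual
    data FiniteTree (P : Program) : Query → Set where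
      success  : FiniteTree P []
      positive : ∀ {A Ls} → All (Child P (pos A ∷ Ls)) P →
                 FiniteTree P (pos A ∷ Ls)
      negStep  : ∀ {A Ls} → Ground A →
                 (T : FiniteTree P [ pos A ]) → FinitelyFailed T →
                 FiniteTree P Ls → FiniteTree P (neg A ∷ Ls)
      negFail  : ∀ {A Ls} → Ground A →
                 (T : FiniteTree P [ pos A ]) → HasSuccess T →
                 FiniteTree P (neg A ∷ Ls)
      negStuck : ∀ {A Ls} → Ground A →
                 (T : FiniteTree P [ pos A ]) →
                 ¬ FinitelyFailed T → ¬ HasSuccess T →
                 FiniteTree P (neg A ∷ Ls)
      flounder : ∀ {A Ls} → ¬ Ground A → FiniteTree P (neg A ∷ Ls)

    data Child (P : Program) (Q : Query) (c : Clause) : Set where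
      child   : ∀ {Q′} → ResolventVia c Q Q′ → FiniteTree P Q′ → Child P Q c
      noChild : (∀ {Q′} → ¬ ResolventVia c Q Q′) → Child P Q c

    outcomes : ∀ {P Q} → FiniteTree P Q → List Outcome
    outcomes success              = [ successful ]
    outcomes (positive cs)        = failedIfLeaf (childOutcomes cs)
    outcomes (negStep _ _ _ T)    = outcomes T
    outcomes (negFail _ _ _)      = [ failed ]
    outcomes (negStuck _ _ _ _)   = [ floundered ]
    outcomes (flounder _)         = [ floundered ]

    childOutcomes : ∀ {P Q cs} → All (Child P Q) cs → List Outcome
    childOutcomes []                = []
    childOutcomes (child _ T  ∷ cs) = outcomes T ++ childOutcomes cs
    childOutcomes (noChild _  ∷ cs) = childOutcomes cs

    -- Every tree has at least one branch, so the list is empty precisely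
    -- when there are no children.
    failedIfLeaf : List Outcome → List Outcome
    failedIfLeaf []       = [ failed ]
    failedIfLeaf (o ∷ os) = o ∷ os

    FinitelyFailed : ∀ {P Q} → FiniteTree P Q → Set
    FinitelyFailed T = All (_≡ failed) (outcomes T)

    HasSuccess : ∀ {P Q} → FiniteTree P Q → Set
    HasSuccess T = successful ∈ outcomes T

  -- If the subsidiary tree for ¬A diverges,
  -- there is no T, hence no resolvent.
  data Resolvent (P : Program) : Query → Query → Set where
    positive : ∀ {c Q Q′} → c ∈ P → ResolventVia c Q Q′ → Resolvent P Q Q′
    negative : ∀ {A Ls} → Ground A →
               (T : FiniteTree P [ pos A ]) → FinitelyFailed T →
               Resolvent P (neg A ∷ Ls) Ls

  data Descendant (P : Program) (Q : Query) : Query → Set where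
    root       : Descendant P Q Q
    step       : ∀ {Q′ Q″} → Descendant P Q Q′ → Resolvent P Q′ Q″ →
                 Descendant P Q Q″
    subsidiary : ∀ {A Ls} → Descendant P Q (neg A ∷ Ls) → Ground A →
                 Descendant P Q [ pos A ]

  Call : Program → Query → Pred Literal 0ℓ
  Call P Q L = ∃ λ Ls → Descendant P Q (L ∷ Ls)

  _OccursIn_ : Rel → Program → Set
  p OccursIn P = Any (λ c → p ∈ rel (head c) ∷ map relᴸ (body c)) P

  _DefinedIn_ : Rel → Program → Set
  p DefinedIn P = Any (λ c → p ≡ rel (head c)) P

  infix 4 _⊐_
  _⊐_ : Program → Program → Set
  P ⊐ R = ∀ p → p DefinedIn P → ¬ (p OccursIn R)

  -- Each component extends the union of the preceding ones; for the first
  -- component that union is empty and the condition is vacuous.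
  Hierarchy : ∀ {n} → (Fin n → Program) → Set
  Hierarchy R = ∀ i → R i ⊐ ⋃ (take (toℕ i) (tabulate R))

  -- B_P.  The proofs are irrelevant, so levels depend on the atom only.
  record BaseAtom (P : Program) : Set where
    constructor baseAtom
    field
      theAtom  : Atom
      .ground  : Ground theAtom
      .occurs  : rel theAtom OccursIn P
  open BaseAtom public using (theAtom)

  LevelMapping : Program → Set
  LevelMapping P = BaseAtom P → ℕ

  Bounded : ∀ {P} → LevelMapping P → Atom → Set
  Bounded {P} ∣_∣ A =
    Finite λ k → Σ (BaseAtom P) λ A′ → (theAtom A′ InstanceOf A) × (∣ A′ ∣ ≡ k)

  StronglyBounded : ∀ {n} (R : Fin n → Program) →
                    (∀ i → LevelMapping (R i)) → Query → Set
  StronglyBounded R level Q =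
    ∀ A → Call (⋃ (tabulate R)) Q (pos A) →
    ∀ i → rel A DefinedIn R i → Bounded (level i) A

  record Type : Set₁ where
    field
      Contains : Pred Term 0ℓ
      closed   : ∀ t σ → Contains t → Contains (t [ σ ]ᵀ)
  open Type public

  record Typing : Set₁ where
    field
      mode : (p : Rel) → Fin (relArity p) → Mode
      type : (p : Rel) → Fin (relArity p) → Type

  TypedTerms : Set₁
  TypedTerms = List (Term × Type)

  _HoldsUnder_ : TypedTerms → Subst → Set₁
  Γ HoldsUnder θ = All (λ (t , T) → Contains T (t [ θ ]ᵀ)) Γ

  infix 4 ⊨_⇒_
  ⊨_⇒_ : TypedTerms → TypedTerms → Set₁
  ⊨ Γ ⇒ Δ = ∀ θ → Γ HoldsUnder θ → Δ HoldsUnder θ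

  module WellTyping (τ : Typing) where
    open Typing τ

    positions : Mode → Atom → TypedTerms
    positions m A =
      map (λ k → lookupᵛ (args A) k , type (rel A) k)
          (filter (λ k → mode (rel A) k ≟ᵐ m) (allFin (relArity (rel A))))

    inputs outputs : Literal → TypedTerms
    inputs (pos A) = positions input A
    inputs (neg A) = positions input A
    outputs (pos A) = positions output A
    outputs (neg A) = positions output A

    positives : Query → Query
    positives []           = []
    positives (pos A ∷ Ls) = pos A ∷ positives Ls
    positives (neg A ∷ Ls) = positives Ls

    positiveOutputs : Query → TypedTerms
    positiveOutputs Ls = concatMap outputs (positives Ls)

    WellTypedQuery : Query → Set₁
    WellTypedQuery Q = ∀ (j : Fin (length Q)) →
      ⊨ positiveOutputs (take (toℕ j) Q) ⇒ inputs (lookup Q j)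

    WellTypedClause : Clause → Set₁
    WellTypedClause (H ⟵ B) =
      (∀ (j : Fin (length B)) →
        ⊨ inputs (pos H) ++ positiveOutputs (take (toℕ j) B) ⇒ inputs (lookup B j))
      × (⊨ inputs (pos H) ++ positiveOutputs B ⇒ outputs (pos H))

    WellTypedProgram : Program → Set₁
    WellTypedProgram P = All WellTypedClause P

    WellTypedAtom : Atom → Set₁
    WellTypedAtom A = WellTypedQuery [ pos A ]

-- Well-typedness is preserved by resolution, so every LDNF-descendant of a
-- well-typed query is well-typed; the first atom of a well-typed query is
-- itself well-typed and hence bounded by hypothesis.  Preservation: under the
-- mgu θ of A and H, the inputs of Hθ = Aθ hold, so Bθ is well-typed
-- unconditionally, and its outputs imply those of Hθ = Aθ, on which the
-- remaining literals of the query rely.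
module Submission where

open import Defs
open import Data.Nat.Base using (ℕ; _⊔_)
open import Data.Nat.Properties using (≤-trans; m≤m⊔n; m≤n⊔m)
open import Data.Fin.Base using (Fin; zero; suc; toℕ)
open import Data.List.Base
  using (List; []; _∷_; [_]; _++_; map; filter; take; length; lookup;
         tabulate; allFin)
open import Data.List.Properties using (map-∘; map-cong; map-++; ++-assoc)
open import Data.List.Relation.Unary.All as All using (All; []; _∷_)
open import Data.List.Relation.Unary.All.Properties
  using (++⁺; ++⁻; map⁺; map⁻)
open import Data.Product.Base using (_,_; map₁)
open import Data.Vec.Base using (Vec; []; _∷_) renaming (lookup to lookupᵛ)
open import Relation.Binary.PropositionalEquality
  using (_≡_; refl; sym; trans; cong; cong₂; subst; subst₂)

module _ (ℒ : Language) where
  open LogicPrograms ℒ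

  infixl 9 _⨟_
  _⨟_ : Subst → Subst → Subst
  ⟦ σ ⨟ η ⟧ x = ⟦ σ ⟧ x [ η ]ᵀ
  bound (σ ⨟ η) = bound σ ⊔ bound η
  fixes (σ ⨟ η) x le =
    trans (cong (_[ η ]ᵀ) (fixes σ x (≤-trans (m≤m⊔n (bound σ) (bound η)) le)))
          (fixes η x (≤-trans (m≤n⊔m (bound σ) (bound η)) le))

  mutual
    []ᵀ-⨟ : ∀ t σ η → t [ σ ⨟ η ]ᵀ ≡ t [ σ ]ᵀ [ η ]ᵀ
    []ᵀ-⨟ (var x)    σ η = refl
    []ᵀ-⨟ (fun f ts) σ η = cong (fun f) ([]ᵛ-⨟ ts σ η)

    []ᵛ-⨟ : ∀ {n} (ts : Vec Term n) σ η → ts [ σ ⨟ η ]ᵛ ≡ ts [ σ ]ᵛ [ η ]ᵛ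
    []ᵛ-⨟ []       σ η = refl
    []ᵛ-⨟ (t ∷ ts) σ η = cong₂ _∷_ ([]ᵀ-⨟ t σ η) ([]ᵛ-⨟ ts σ η)

  lookup-[]ᵛ : ∀ {n} (ts : Vec Term n) σ k →
               lookupᵛ (ts [ σ ]ᵛ) k ≡ lookupᵛ ts k [ σ ]ᵀ
  lookup-[]ᵛ (t ∷ ts) σ zero    = refl
  lookup-[]ᵛ (t ∷ ts) σ (suc k) = lookup-[]ᵛ ts σ k

  infixl 21 _[_]ᴳ
  _[_]ᴳ : TypedTerms → Subst → TypedTerms
  Γ [ σ ]ᴳ = map (map₁ (_[ σ ]ᵀ)) Γ

  holds-⨟⁺ : ∀ {Γ} σ η → Γ [ σ ]ᴳ HoldsUnder η → Γ HoldsUnder (σ ⨟ η)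
  holds-⨟⁺ σ η h =
    All.map (λ {(t , T)} → subst (Contains T) (sym ([]ᵀ-⨟ t σ η))) (map⁻ h)

  holds-⨟⁻ : ∀ {Γ} σ η → Γ HoldsUnder (σ ⨟ η) → Γ [ σ ]ᴳ HoldsUnder η
  holds-⨟⁻ σ η h =
    map⁺ (All.map (λ {(t , T)} → subst (Contains T) ([]ᵀ-⨟ t σ η)) h)

  -- A judgement quantifies over all substitutions, so its instance at `σ ⨟ η` is the substituted
  -- judgement at `η`.
  ⊨-[] : ∀ {Γ Δ} σ → ⊨ Γ ⇒ Δ → ⊨ Γ [ σ ]ᴳ ⇒ Δ [ σ ]ᴳ
  ⊨-[] σ d η h = holds-⨟⁻ σ η (d (σ ⨟ η) (holds-⨟⁺ σ η h))

  module _ (τ : Typing) where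
    open Typing τ
    open WellTyping τ

    positions-[] : ∀ m A σ → positions m (A [ σ ]ᴬ) ≡ positions m A [ σ ]ᴳ
    positions-[] m A σ =
      trans (map-cong (λ k → cong (_, type (rel A) k) (lookup-[]ᵛ (args A) σ k)) ks)
            (map-∘ ks)
      where
      ks : List (Fin _)
      ks = filter (λ k → mode (rel A) k ≟ᵐ m) (allFin _)

    inputs-[] : ∀ L σ → inputs (L [ σ ]ᴸ) ≡ inputs L [ σ ]ᴳ
    inputs-[] (pos A) = positions-[] input A
    inputs-[] (neg A) = positions-[] input A

    positiveOutputs-∷ : ∀ L Q →
      positiveOutputs (L ∷ Q) ≡ positiveOutputs [ L ] ++ positiveOutputs Q
    positiveOutputs-∷ (pos A) Q =
      sym (++-assoc (outputs (pos A)) [] (positiveOutputs Q))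
    positiveOutputs-∷ (neg A) Q = refl

    positiveOutputs-[] : ∀ Q σ →
      positiveOutputs (Q [ σ ]ᵠ) ≡ positiveOutputs Q [ σ ]ᴳ
    positiveOutputs-[] []          σ = refl
    positiveOutputs-[] (pos A ∷ Q) σ =
      trans (cong₂ _++_ (positions-[] output A σ) (positiveOutputs-[] Q σ))
            (sym (map-++ _ (outputs (pos A)) (positiveOutputs Q)))
    positiveOutputs-[] (neg A ∷ Q) σ = positiveOutputs-[] Q σ

    infixr 5 _∷_
    -- Recursive form of well-typedness, where `Γ` collects what is known to the left of the query.
    -- It serves queries (`Γ` empty) and clause bodies (`Γ` the inputs of the head) alike. A
    -- negative literal adds nothing to `Γ`.
    data WellTypedAfter : TypedTerms → Query → Set₁ where
      []  : ∀ {Γ} → WellTypedAfter Γ []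
      _∷_ : ∀ {Γ L Q} → ⊨ Γ ⇒ inputs L →
            WellTypedAfter (Γ ++ positiveOutputs [ L ]) Q →
            WellTypedAfter Γ (L ∷ Q)

    fromPositions : ∀ {Γ} Q →
      (∀ (j : Fin (length Q)) →
        ⊨ Γ ++ positiveOutputs (take (toℕ j) Q) ⇒ inputs (lookup Q j)) →
      WellTypedAfter Γ Q
    fromPositions []          wt = []
    fromPositions {Γ} (L ∷ Q) wt =
      -- At position `zero` no literal precedes, so the given context is `Γ ++ []`.
      (λ θ h → wt zero θ (++⁺ h [])) ∷
      fromPositions Q λ j →
        subst (⊨_⇒ inputs (lookup Q j))
          (trans (cong (Γ ++_) (positiveOutputs-∷ L (take (toℕ j) Q)))
                 (sym (++-assoc Γ (positiveOutputs [ L ]) _)))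
          (wt (suc j))

    firstWellTyped : ∀ {A Ls} → WellTypedAfter [] (pos A ∷ Ls) → WellTypedAtom A
    firstWellTyped (i ∷ _) zero = i

    -- Contexts act contravariantly. Passing a literal appends the same outputs to both contexts, so
    -- `d` is needed only on the part before them.
    weaken : ∀ {Γ Δ Q} → ⊨ Δ ⇒ Γ → WellTypedAfter Γ Q → WellTypedAfter Δ Q
    weaken         d []       = []
    weaken {Γ} {Δ} d (i ∷ wt) =
      (λ θ h → i θ (d θ h)) ∷
      weaken (λ θ h → let hΔ , hL = ++⁻ Δ h in ++⁺ (d θ hΔ) hL) wt

    wellTyped-++ : ∀ {Γ Q Q′} → WellTypedAfter Γ Q →
      WellTypedAfter (Γ ++ positiveOutputs Q) Q′ → WellTypedAfter Γ (Q ++ Q′)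
    wellTyped-++ {Γ} [] wt′ = weaken (λ θ h → ++⁺ h []) wt′
    wellTyped-++ {Γ} {L ∷ Q} {Q′} (i ∷ wt) wt′ =
      i ∷ wellTyped-++ wt
        (subst (λ Δ → WellTypedAfter Δ Q′)
          (trans (cong (Γ ++_) (positiveOutputs-∷ L Q))
                 (sym (++-assoc Γ (positiveOutputs [ L ]) (positiveOutputs Q))))
          wt′)

    wellTyped-[] : ∀ {Γ Q} σ → WellTypedAfter Γ Q →
                   WellTypedAfter (Γ [ σ ]ᴳ) (Q [ σ ]ᵠ)
    wellTyped-[] σ [] = []
    wellTyped-[] {Γ} {L ∷ Q} σ (i ∷ wt) =
      subst (⊨ _ ⇒_) (sym (inputs-[] L σ)) (⊨-[] {Γ} σ i) ∷
      subst (λ Δ → WellTypedAfter Δ (Q [ σ ]ᵠ))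
        (trans (map-++ _ Γ (positiveOutputs [ L ]))
               (cong (Γ [ σ ]ᴳ ++_) (sym (positiveOutputs-[] [ L ] σ))))
        (wellTyped-[] σ wt)

    -- The clause condition with its body in recursive form, which makes stability under
    -- substitution a direct consequence of `wellTyped-[]`.
    record WellTypedRule (c : Clause) : Set₁ where
      field
        bodyWellTyped : WellTypedAfter (inputs (pos (head c))) (body c)
        headOutputs   : ⊨ inputs (pos (head c)) ++ positiveOutputs (body c)
                        ⇒ outputs (pos (head c))
    open WellTypedRule

    rule : ∀ c → WellTypedClause c → WellTypedRule c
    rule c (b , o) = record { bodyWellTyped = fromPositions (body c) b
                            ; headOutputs   = o }

    rule-[] : ∀ {c} σ → WellTypedRule c → WellTypedRule (c [ σ ]ᶜ)
    bodyWellTyped (rule-[] {H ⟵ B} σ r) =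
      subst (λ Δ → WellTypedAfter Δ (B [ σ ]ᵠ)) (sym (positions-[] input H σ))
        (wellTyped-[] σ (bodyWellTyped r))
    headOutputs (rule-[] {H ⟵ B} σ r) =
      subst₂ ⊨_⇒_
        (trans (map-++ _ (inputs (pos H)) (positiveOutputs B))
               (cong₂ _++_ (sym (positions-[] input H σ))
                           (sym (positiveOutputs-[] B σ))))
        (sym (positions-[] output H σ))
        (⊨-[] σ (headOutputs r))

    wellTyped-unfold : ∀ {A H B Ls} → A ≡ H → WellTypedRule (H ⟵ B) →
      WellTypedAfter [] (pos A ∷ Ls) → WellTypedAfter [] (B ++ Ls)
    wellTyped-unfold {B = B} refl r (i ∷ wt) =
      -- Since `A` comes first, `i` proves its inputs from the empty context; these are the inputs
      -- of `H`, so the body needs no assumptions.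
      wellTyped-++ (weaken i (bodyWellTyped r))
        -- `Ls` relied on the outputs of `A`, which are those of `H`; the outputs of `B` now imply
        -- them. The final `[]` matches the trailing empty list left by `concatMap`.
        (weaken (λ θ h → ++⁺ (headOutputs r θ (++⁺ (i θ []) h)) []) wt)

    wellTyped-resolvent : ∀ {c Q Q′} → WellTypedRule c → ResolventVia c Q Q′ →
                          WellTypedAfter [] Q → WellTypedAfter [] Q′
    wellTyped-resolvent r (resolvent {A} {Ls} {H} {B} {θ} ((σ , refl) , _) _ (A≡H , _)) wt =
      subst (WellTypedAfter []) (sym (map-++ _ B Ls))
        -- The rule is instantiated twice: `σ` turns the program clause into its variant, then `θ`
        -- makes its head equal to the selected atom.
        (wellTyped-unfold A≡H (rule-[] θ (rule-[] σ r)) (wellTyped-[] θ wt))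

    wellTyped-descendant : ∀ {P Q Q′} → WellTypedProgram P →
      WellTypedAfter [] Q → Descendant P Q Q′ → WellTypedAfter [] Q′
    wellTyped-descendant wp wt root = wt
    wellTyped-descendant wp wt (step d (positive c∈P r)) =
      wellTyped-resolvent (rule _ (All.lookup wp c∈P)) r
        (wellTyped-descendant wp wt d)
    -- The deleted literal is negative and has contributed no outputs, so the tail is already
    -- well-typed in the empty context.
    wellTyped-descendant wp wt (step d (negative _ _ _))
      with wellTyped-descendant wp wt d
    ... | _ ∷ wt′ = wt′
    -- `neg A` and `pos A` have the same inputs, so the judgement for the negated literal is the one
    -- for the subsidiary root.
    wellTyped-descendant wp wt (subsidiary d _)
      with wellTyped-descendant wp wt d
    ... | i ∷ _ = i ∷ []

proposition31 : (ℒ : Language) → let open LogicPrograms ℒ in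
    (τ : Typing) → let open WellTyping τ in
    (n : ℕ) (R : Fin n → Program) (level : ∀ i → LevelMapping (R i)) →
    WellTypedProgram (⋃ (tabulate R)) →
    Hierarchy R →
    (∀ A → WellTypedAtom A → ∀ i → rel A DefinedIn R i → Bounded (level i) A) →
    ∀ Q → WellTypedQuery Q → StronglyBounded R level Q
proposition31 ℒ τ n R level wp _ bounded Q wq A (Ls , d) =
  bounded A (firstWellTyped ℒ τ
    (wellTyped-descendant ℒ τ wp (fromPositions ℒ τ Q wq) d))
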